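{- Let $q$ be an odd prime power and let $G=\mathrm{PSL}(2,q)$ act on the projective line $\mathbb{F}_q\cup\{\infty\}$ by fractional linear transformations. Let $S$ and $N$ be the sets of nonzero squares and non-squares of $\mathbb{F}_q$, fix a non-square $\zeta$, and put $L_s=\{g\in G: g(0)\in S\}$, $\Pi=\{(s,t): s\in S, t\in N, t-s\in S\}$, $\Lambda=\{(s,t): s,t\in S, t-s\in N\}$. For a set $\Omega$ of pairs of points let $A_\Omega=\{g\in G:(g(0),g(\infty))\in\Omega\}$ and $-\Omega=\{(a,b):(\zeta a,\zeta b)\in\Omega\}$. If $q\equiv 3\pmod 4$, then $(L_s\setminus A_\Pi)\cup A_{ -\Pi}$ is a Cameron-Liebler set; if $q\equiv 1\pmod 4$, then $(L_s\setminus A_\Lambda)\cup A_{ -\Lambda}$ is a Cameron-Liebler set.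
   Context: For $a,b$ in the projective line, the star is $G_{a\to b}=\{g\in G:g(a)=b\}$ with indicator vector $\mathbf{v}_{a,b}$. A Cameron-Liebler set (for this action) is a subset of $G$ whose indicator vector is a linear combination of the $\mathbf{v}_{a,b}$. -}

module Defs where

open import Level using (0ℓ)
open import Data.Nat using (ℕ)
open import Data.Product using (Σ; ∃; _×_; _,_)
open import Data.Sum using (_⊎_)
open import Data.Empty using (⊥)
open import Data.List using (List; []; _∷_; map; length)
open import Data.List.Membership.Propositional using (_∈_)
open import Data.List.Relation.Unary.Unique.Propositional using (Unique)
open import Data.Rational using (ℚ; 0ℚ; 1ℚ) renaming (_+_ to _+ℚ_; _*_ to _*ℚ_)
open import Relation.Nullary using (¬_; Dec; yes; no)
open import Relation.Binary.Definitions using (DecidableEquality)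
open import Relation.Binary.PropositionalEquality using (_≡_; _≢_; refl; cong)
open import Algebra.Structures using (IsCommutativeRing)

-- A finite field (with propositional equality), given with an explicit
-- enumeration of its elements; its order is q = length elements.
record FiniteField : Set₁ where
  infixl 6 _+_
  infixl 7 _*_
  field
    F          : Set
    _≟_        : DecidableEquality F
    _+_ _*_    : F → F → F
    -_         : F → F
    0# 1#      : F
    _⁻¹        : F → F
    isCommRing : IsCommutativeRing _≡_ _+_ _*_ -_ 0# 1#
    0≢1        : 0# ≢ 1#
    inverseʳ   : ∀ x → x ≢ 0# → x * (x ⁻¹) ≡ 1#
    elements   : List F
    complete   : ∀ x → x ∈ elements
    unique     : Unique elements

  order : ℕ
  order = length elements

module Over (𝔽 : FiniteField) where
  open FiniteField 𝔽

  -- the projective line F_q ∪ {∞}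
  data P1 : Set where
    pt : F → P1
    ∞  : P1

  P1-elements : List P1
  P1-elements = ∞ ∷ map pt elements

  _≟P_ : DecidableEquality P1
  pt x ≟P pt y with x ≟ y
  ... | yes refl = yes refl
  ... | no x≢y = no λ { refl → x≢y refl }
  pt x ≟P ∞ = no λ ()
  ∞ ≟P pt y = no λ ()
  ∞ ≟P ∞ = yes refl

  -- elements of SL(2,q); an element of PSL(2,q) is represented by
  -- either of its two preimages ±M (all sets considered are defined
  -- through the action, hence invariant under M ↦ -M).
  record SL2 : Set where
    constructor mat
    field
      a b c d : F
      det     : a * d + - (b * c) ≡ 1#

  -- fractional linear action  x ↦ (a x + b)/(c x + d)
  act : SL2 → P1 → P1
  act (mat a b c d _) (pt x) with (c * x + d) ≟ 0#
  ... | yes _ = ∞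
  ... | no _  = pt ((a * x + b) * ((c * x + d) ⁻¹))
  act (mat a b c d _) ∞ with c ≟ 0#
  ... | yes _ = ∞
  ... | no _  = pt (a * (c ⁻¹))

  -- indicator vector of the star G_{a→b}, evaluated at g
  star : P1 → P1 → SL2 → ℚ
  star x y g with act g x ≟P y
  ... | yes _ = 1ℚ
  ... | no _  = 0ℚ

  sumℚ : List ℚ → ℚ
  sumℚ []       = 0ℚ
  sumℚ (r ∷ rs) = r +ℚ sumℚ rs

  -- Σ_{a,b} c_{a,b} v_{a,b} evaluated at g
  combo : (P1 → P1 → ℚ) → SL2 → ℚ
  combo coef g =
    sumℚ (map (λ x → sumℚ (map (λ y → coef x y *ℚ star x y g) P1-elements))
              P1-elements)

  -- X ⊆ G is Cameron–Liebler iff its indicator vector is a (rational)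
  -- linear combination of the star indicator vectors.
  CameronLiebler : (SL2 → Set) → Set
  CameronLiebler X =
    Σ (P1 → P1 → ℚ) λ coef → ∀ g →
      (X g → combo coef g ≡ 1ℚ) × (¬ X g → combo coef g ≡ 0ℚ)

  -- nonzero squares and non-squares
  IsSquare : F → Set
  IsSquare x = (x ≢ 0#) × ∃ λ y → y * y ≡ x

  IsNonSquare : F → Set
  IsNonSquare x = (x ≢ 0#) × ¬ (∃ λ y → y * y ≡ x)

  Ls : SL2 → Set
  Ls g = Σ F λ x → (act g (pt 0#) ≡ pt x) × IsSquare x

  Π : P1 → P1 → Set
  Π (pt s) (pt t) = IsSquare s × IsNonSquare t × IsSquare (t + - s)
  Π _ _ = ⊥

  Λ : P1 → P1 → Set
  Λ (pt s) (pt t) = IsSquare s × IsSquare t × IsNonSquare (t + - s)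
  Λ _ _ = ⊥

  scale : F → P1 → P1
  scale z (pt x) = pt (z * x)
  scale z ∞      = ∞

  -- -Ω = {(a,b) : (ζa, ζb) ∈ Ω}
  neg : F → (P1 → P1 → Set) → (P1 → P1 → Set)
  neg ζ Ω x y = Ω (scale ζ x) (scale ζ y)

  -- A_Ω = {g : (g(0), g(∞)) ∈ Ω}
  A : (P1 → P1 → Set) → SL2 → Set
  A Ω g = Ω (act g (pt 0#)) (act g ∞)

-- Write χ for the quadratic character of F_q (0 at 0, ±1 on squares and non-squares) and give
-- ∞ the class of 0. For g = (a b; c d) of determinant 1 the points g(0) = b/d, g(∞) = a/c,
-- -g⁻¹(∞) = d/c and -g⁻¹(0) = b/a have the classes χ(bd), χ(ac), χ(cd), χ(ab), and
-- g(∞) - g(0) = 1/(cd). So membership of g in the set, and the value at g of a combination of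
-- the stars from 0, from ∞, to ∞ and to 0 with weights depending only on classes, are both
-- functions of these four classes. The determinant leaves only a few patterns for them, depending
-- on χ(-1), i.e. on q mod 4; on each, the stars from 0 to the squares plus ±1/4 times the classes
-- reproduce the characteristic vector. Multiplicativity of χ and the value of χ(-1) come from
-- counting squares.
module Submission where

open import Defs
open import Data.Nat using (_%_)
open import Data.Product using (_×_)
open import Data.Sum using (_⊎_)
open import Relation.Nullary using (¬_)
open import Relation.Binary.PropositionalEquality using (_≡_)

open import Algebra.Bundles using (CommutativeRing; CommutativeMonoid)
open import Data.Bool.Base using (Bool; true; false; not; T)
open import Data.Empty using (⊥; ⊥-elim)
import Data.Integer.Base as ℤ
import Data.Integer.Properties as ℤₚ
open import Data.List.Base using (List; []; _∷_; map; length; filter; _++_)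
open import Data.List.Membership.Propositional using (_∈_)
open import Data.List.Membership.Propositional.Properties
  using (∈-filter⁺; ∈-map⁺; ∈-∃++; ∈-++⁻; ∈-++⁺ˡ; ∈-++⁺ʳ)
open import Data.List.Properties using (length-map; length-++; map-cong)
open import Data.List.Relation.Unary.All as All using (All; []; _∷_)
import Data.List.Relation.Unary.All.Properties as All
import Data.List.Relation.Unary.Any as Any
open Any using (here; there)
open import Data.List.Relation.Unary.Unique.Propositional using (Unique; []; _∷_)
import Data.List.Relation.Unary.Unique.Propositional.Properties as Unique
open import Data.Nat.Base as ℕ using (ℕ)
import Data.Nat.Properties as ℕₚ
open import Data.Nat.DivMod using ([m+kn]%n≡m%n)
open import Data.Nat.Tactic.RingSolver using () renaming (solve-∀ to ℕ-solve-∀)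
open import Data.Product.Base using (Σ; ∃; _,_; proj₁; proj₂)
open import Data.Product.Function.NonDependent.Propositional using (_×-⇔_)
open import Data.Rational.Base as ℚ using (ℚ; 0ℚ; 1ℚ; _/_) renaming (_+_ to _+ℚ_; _*_ to _*ℚ_)
import Data.Rational.Properties as ℚₚ
open import Data.Sign.Base as Sign using (Sign)
import Data.Sign.Properties as Signₚ
open import Data.Sum.Base using (inj₁; inj₂)
open import Data.Sum.Function.Propositional using (_⊎-⇔_)
open import Data.Unit.Base using (⊤; tt)
open import Function.Base using (_∘_; _∘′_; id; case_of_)
open import Function.Bundles using (_⇔_; mk⇔; module Equivalence)
import Function.Properties.Equivalence as ⇔
open import Function.Related.TypeIsomorphisms using (¬-cong-⇔)
open import Level using (0ℓ)
open import Relation.Binary.Definitions using (DecidableEquality)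
open import Relation.Binary.PropositionalEquality
  using (_≢_; refl; sym; trans; cong; cong₂; subst; subst₂; module ≡-Reasoning)
open import Relation.Nullary.Decidable using (Dec; yes; no; does; map′; ¬?; T?; _×-dec_; _⊎-dec_)
open import Relation.Unary using (Pred; Decidable)
open import Relation.Unary.Properties using (_∩?_; ∁?)

-- Ring solver

-- ℤ is the initial ring, so every commutative ring can use the ring solver with
-- integer coefficients, whose equality (unlike the ring's own) computes.
module IntegerRingSolver {c ℓ} (R : CommutativeRing c ℓ) where
  open CommutativeRing R renaming (refl to ≈-refl; sym to ≈-sym; trans to ≈-trans)
  open import Algebra.Properties.AbelianGroup +-abelianGroup using (⁻¹-∙-comm)
  open import Algebra.Properties.CommutativeSemigroup +-commutativeSemigroup using (interchange)
  open import Algebra.Properties.Ring ring using (-‿involutive; -0#≈0#; -‿distribˡ-*; -‿distribʳ-*)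
  open import Algebra.Properties.Semiring.Mult.TCOptimised semiring
    using (1+×; ×-homo-+; ×1-homo-*) renaming (_×_ to _×′_)
  open import Algebra.Solver.Ring.AlmostCommutativeRing
    using (fromCommutativeRing; _-Raw-AlmostCommutative⟶_)
  import Data.Maybe.Base as Maybe
  open import Data.Nat.Base using (zero; suc)
  open import Relation.Binary.Reasoning.Setoid setoid
  open import Relation.Nullary.Decidable using (dec⇒maybe)
  open ℤ using (+_; -[1+_]; _⊖_)

  ⟦_⟧ℤ : ℤ.ℤ → Carrier
  ⟦ + n ⟧ℤ      = n ×′ 1#
  ⟦ -[1+ n ] ⟧ℤ = - (suc n ×′ 1#)

  ⟦-⟧ℤ : ∀ i → ⟦ ℤ.- i ⟧ℤ ≈ - ⟦ i ⟧ℤ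
  ⟦-⟧ℤ (+ zero)  = ≈-sym -0#≈0#
  ⟦-⟧ℤ (+ suc n) = ≈-refl
  ⟦-⟧ℤ -[1+ n ]  = ≈-sym (-‿involutive _)

  ⟦⊖⟧ℤ : ∀ m n → ⟦ m ⊖ n ⟧ℤ ≈ m ×′ 1# - n ×′ 1#
  ⟦⊖⟧ℤ zero    zero    = ≈-sym (≈-trans (+-congˡ -0#≈0#) (+-identityʳ 0#))
  ⟦⊖⟧ℤ zero    (suc n) = ≈-sym (+-identityˡ _)
  ⟦⊖⟧ℤ (suc m) zero    = ≈-sym (≈-trans (+-congˡ -0#≈0#) (+-identityʳ _))
  ⟦⊖⟧ℤ (suc m) (suc n) = begin
    ⟦ suc m ⊖ suc n ⟧ℤ                  ≡⟨ cong ⟦_⟧ℤ (ℤₚ.[1+m]⊖[1+n]≡m⊖n m n) ⟩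
    ⟦ m ⊖ n ⟧ℤ                          ≈⟨ ⟦⊖⟧ℤ m n ⟩
    m ×′ 1# - n ×′ 1#                   ≈⟨ +-identityˡ _ ⟨
    0# + (m ×′ 1# - n ×′ 1#)            ≈⟨ +-congʳ (-‿inverseʳ 1#) ⟨
    (1# - 1#) + (m ×′ 1# - n ×′ 1#)     ≈⟨ interchange _ _ _ _ ⟩
    (1# + m ×′ 1#) + (- 1# - n ×′ 1#)   ≈⟨ +-cong (≈-sym (1+× m 1#)) (⁻¹-∙-comm 1# (n ×′ 1#)) ⟩
    suc m ×′ 1# - (1# + n ×′ 1#)        ≈⟨ +-congˡ (-‿cong (1+× n 1#)) ⟨
    suc m ×′ 1# - suc n ×′ 1#           ∎

  ⟦+⟧ℤ : ∀ i j → ⟦ i ℤ.+ j ⟧ℤ ≈ ⟦ i ⟧ℤ + ⟦ j ⟧ℤ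
  ⟦+⟧ℤ (+ m)    (+ n)    = ×-homo-+ 1# m n
  ⟦+⟧ℤ (+ m)    -[1+ n ] = ⟦⊖⟧ℤ m (suc n)
  ⟦+⟧ℤ -[1+ m ] (+ n)    = ≈-trans (⟦⊖⟧ℤ n (suc m)) (+-comm _ _)
  ⟦+⟧ℤ -[1+ m ] -[1+ n ] = begin
    - (suc (suc (m ℕ.+ n)) ×′ 1#)       ≡⟨ cong (λ k → - (suc k ×′ 1#)) (ℕₚ.+-suc m n) ⟨
    - ((suc m ℕ.+ suc n) ×′ 1#)         ≈⟨ -‿cong (×-homo-+ 1# (suc m) (suc n)) ⟩
    - (suc m ×′ 1# + suc n ×′ 1#)       ≈⟨ ⁻¹-∙-comm _ _ ⟨
    - (suc m ×′ 1#) - (suc n ×′ 1#)     ∎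

  ⟦+*⟧ℤ : ∀ m j → ⟦ + m ℤ.* j ⟧ℤ ≈ ⟦ + m ⟧ℤ * ⟦ j ⟧ℤ
  ⟦+*⟧ℤ m (+ n)    = ≈-trans (reflexive (cong ⟦_⟧ℤ (sym (ℤₚ.pos-* m n)))) (×1-homo-* m n)
  ⟦+*⟧ℤ m -[1+ n ] = begin
    ⟦ + m ℤ.* ℤ.- (+ suc n) ⟧ℤ          ≡⟨ cong ⟦_⟧ℤ (ℤₚ.neg-distribʳ-* (+ m) (+ suc n)) ⟨
    ⟦ ℤ.- (+ m ℤ.* + suc n) ⟧ℤ          ≈⟨ ⟦-⟧ℤ (+ m ℤ.* + suc n) ⟩
    - ⟦ + m ℤ.* + suc n ⟧ℤ              ≈⟨ -‿cong (⟦+*⟧ℤ m (+ suc n)) ⟩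
    - (m ×′ 1# * (suc n ×′ 1#))         ≈⟨ -‿distribʳ-* _ _ ⟩
    m ×′ 1# * - (suc n ×′ 1#)           ∎

  ⟦*⟧ℤ : ∀ i j → ⟦ i ℤ.* j ⟧ℤ ≈ ⟦ i ⟧ℤ * ⟦ j ⟧ℤ
  ⟦*⟧ℤ (+ m)    j = ⟦+*⟧ℤ m j
  ⟦*⟧ℤ -[1+ m ] j = begin
    ⟦ ℤ.- (+ suc m) ℤ.* j ⟧ℤ            ≡⟨ cong ⟦_⟧ℤ (ℤₚ.neg-distribˡ-* (+ suc m) j) ⟨
    ⟦ ℤ.- (+ suc m ℤ.* j) ⟧ℤ            ≈⟨ ⟦-⟧ℤ (+ suc m ℤ.* j) ⟩
    - ⟦ + suc m ℤ.* j ⟧ℤ                ≈⟨ -‿cong (⟦+*⟧ℤ (suc m) j) ⟩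
    - (suc m ×′ 1# * ⟦ j ⟧ℤ)            ≈⟨ -‿distribˡ-* _ _ ⟩
    - (suc m ×′ 1#) * ⟦ j ⟧ℤ            ∎

  ℤ⟶R : ℤ.+-*-rawRing -Raw-AlmostCommutative⟶ fromCommutativeRing R
  ℤ⟶R = record
    { ⟦_⟧    = ⟦_⟧ℤ
    ; +-homo = ⟦+⟧ℤ
    ; *-homo = ⟦*⟧ℤ
    ; -‿homo = ⟦-⟧ℤ
    ; 0-homo = ≈-refl
    ; 1-homo = ≈-refl
    }

  open import Algebra.Solver.Ring ℤ.+-*-rawRing (fromCommutativeRing R) ℤ⟶R
    (λ i j → Maybe.map (reflexive ∘ cong ⟦_⟧ℤ) (dec⇒maybe (i ℤₚ.≟ j))) public

-- Counting in a finite enumerated type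

module _ {A : Set} where
  open import Data.Nat.Base using (suc; _+_; _≤_; z≤n; s≤s)

  Unique-map⁺-on : ∀ {P : Pred A 0ℓ} (f : A → A) → (∀ {x y} → P x → P y → f x ≡ f y → x ≡ y) →
                   ∀ {ys} → All P ys → Unique ys → Unique (map f ys)
  Unique-map⁺-on f inj []         []             = []
  Unique-map⁺-on f inj (px ∷ pys) (x∉ys ∷ ys!) =
    All.map⁺ (All.zipWith (λ (x≢y , py) fx≡fy → x≢y (inj px py fx≡fy)) (x∉ys , pys))
    ∷ Unique-map⁺-on f inj pys ys!

  length-mono-⊆ : ∀ {ys zs : List A} → Unique ys → (∀ {x} → x ∈ ys → x ∈ zs) → length ys ≤ length zs
  length-mono-⊆ {[]}     []           ys⊆zs = z≤n
  length-mono-⊆ {y ∷ ys} (y∉ys ∷ ys!) ys⊆zs with ∈-∃++ (ys⊆zs (here refl))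
  ... | us , vs , refl = subst (suc (length ys) ≤_) (sym length-us++y∷vs)
          (s≤s (length-mono-⊆ ys! ys⊆us++vs))
    where
    length-us++y∷vs : length (us ++ y ∷ vs) ≡ suc (length (us ++ vs))
    length-us++y∷vs = trans (length-++ us) (trans (ℕₚ.+-suc _ _) (cong suc (sym (length-++ us))))
    ys⊆us++vs : ∀ {x} → x ∈ ys → x ∈ us ++ vs
    ys⊆us++vs x∈ys with ∈-++⁻ us (ys⊆zs (there x∈ys))
    ... | inj₁ x∈us         = ∈-++⁺ˡ x∈us
    ... | inj₂ (here refl)  = ⊥-elim (All.lookup y∉ys x∈ys refl)
    ... | inj₂ (there x∈vs) = ∈-++⁺ʳ us x∈vs

  length-filter-split : ∀ {P Q : Pred A 0ℓ} (P? : Decidable P) (Q? : Decidable Q) ys →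
    length (filter P? ys) ≡ length (filter (P? ∩? Q?) ys) + length (filter (P? ∩? ∁? Q?) ys)
  length-filter-split P? Q? []       = refl
  length-filter-split P? Q? (y ∷ ys) with does (P? y) | does (Q? y)
  ... | false | _     = length-filter-split P? Q? ys
  ... | true  | true  = cong suc (length-filter-split P? Q? ys)
  ... | true  | false = trans (cong suc (length-filter-split P? Q? ys)) (sym (ℕₚ.+-suc _ _))

  length-filter-partition : ∀ {P : Pred A 0ℓ} (P? : Decidable P) ys →
    length ys ≡ length (filter P? ys) + length (filter (∁? P?) ys)
  length-filter-partition P? []       = refl
  length-filter-partition P? (y ∷ ys) with does (P? y)
  ... | true  = cong suc (length-filter-partition P? ys)
  ... | false = trans (cong suc (length-filter-partition P? ys)) (sym (ℕₚ.+-suc _ _))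

module Counting {A : Set} (_≟_ : DecidableEquality A)
  (xs : List A) (xs! : Unique xs) (xs-complete : ∀ x → x ∈ xs) where

  open import Data.Nat.Base using (suc; _+_; _≤_)

  private variable
    P Q : Pred A 0ℓ

  count : Decidable P → ℕ
  count P? = length (filter P? xs)

  count-≥-unique : (Q? : Decidable Q) → ∀ {ys} → Unique ys → All Q ys → length ys ≤ count Q?
  count-≥-unique Q? ys! qys =
    length-mono-⊆ ys! λ {x} x∈ys → ∈-filter⁺ Q? (xs-complete x) (All.lookup qys x∈ys)

  count-injection : (P? : Decidable P) (Q? : Decidable Q) (f : A → A) →
                    (∀ {x} → P x → Q (f x)) → (∀ {x y} → P x → P y → f x ≡ f y → x ≡ y) →
                    count P? ≤ count Q?
  count-injection {P = P} P? Q? f P⇒Qf inj = subst (_≤ count Q?) (length-map f (filter P? xs))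
    (count-≥-unique Q? (Unique-map⁺-on f inj Ps (Unique.filter⁺ P? xs!)) (All.map⁺ (All.map P⇒Qf Ps)))
    where
    Ps : All P (filter P? xs)
    Ps = All.all-filter P? xs

  count-injection-missing : (P? : Decidable P) (Q? : Decidable Q) (f : A → A) →
                            (∀ {x} → P x → Q (f x)) → (∀ {x y} → P x → P y → f x ≡ f y → x ≡ y) →
                            ∀ {e} → Q e → (∀ {x} → P x → f x ≢ e) → suc (count P?) ≤ count Q?
  count-injection-missing {P = P} P? Q? f P⇒Qf inj {e} qe e∉image = subst (λ n → suc n ≤ count Q?) (length-map f (filter P? xs))
    (count-≥-unique Q? (e∉fPs ∷ Unique-map⁺-on f inj Ps (Unique.filter⁺ P? xs!)) (qe ∷ All.map⁺ (All.map P⇒Qf Ps)))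
    where
    Ps : All P (filter P? xs)
    Ps = All.all-filter P? xs
    e∉fPs : All (e ≢_) (map f (filter P? xs))
    e∉fPs = All.map⁺ (All.map (λ px e≡fx → e∉image px (sym e≡fx)) Ps)

  count-split : (P? : Decidable P) (Q? : Decidable Q) → count P? ≡ count (P? ∩? Q?) + count (P? ∩? ∁? Q?)
  count-split P? Q? = length-filter-split P? Q? xs

  count-partition : (P? : Decidable P) → length xs ≡ count P? + count (∁? P?)
  count-partition P? = length-filter-partition P? xs

  count-singleton : (P? : Decidable P) → ∀ {e} → P e → (∀ {x} → P x → x ≡ e) → count P? ≡ 1
  count-singleton P? pe P⇒≡e = ℕₚ.≤-antisym
    (length-mono-⊆ {zs = _ ∷ []} (Unique.filter⁺ P? xs!) λ x∈ → here (P⇒≡e (All.lookup (All.all-filter P? xs) x∈)))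
    (count-≥-unique P? ([] ∷ []) (pe ∷ []))

  before : A → A → List A → Bool
  before x y []       = false
  before x y (z ∷ zs) with z ≟ x | z ≟ y
  ... | yes _ | _     = true
  ... | no _  | yes _ = false
  ... | no _  | no _  = before x y zs

  before-swap : ∀ {x y} zs → x ≢ y → x ∈ zs → before y x zs ≡ not (before x y zs)
  before-swap {x} {y} (z ∷ zs) x≢y x∈ with z ≟ x | z ≟ y
  ... | yes refl | yes refl = ⊥-elim (x≢y refl)
  ... | yes refl | no _     = refl
  ... | no _     | yes refl = refl
  ... | no z≢x   | no _ with x∈
  ...   | here refl = ⊥-elim (z≢x refl)
  ...   | there x∈zs = before-swap zs x≢y x∈zs

  module Involution (P? : Decidable P) (σ : A → A) (σ-involutive : ∀ {x} → P x → σ (σ x) ≡ x)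
    (σ-closed : ∀ {x} → P x → P (σ x)) (σ-fixfree : ∀ {x} → P x → σ x ≢ x) where

    -- x represents its orbit {x, σ x} if it comes first in xs
    Representative : Pred A 0ℓ
    Representative x = T (before x (σ x) xs)

    representative? : Decidable Representative
    representative? x = T? (before x (σ x) xs)

    representative-σ : ∀ {x} → P x → Representative (σ x) ⇔ (¬ Representative x)
    representative-σ {x} px = subst (λ b → T b ⇔ (¬ Representative x)) (sym before-σx) (T-not _)
      where
      before-σx : before (σ x) (σ (σ x)) xs ≡ not (before x (σ x) xs)
      before-σx = trans (cong (λ y → before (σ x) y xs) (σ-involutive px))
                        (before-swap xs (σ-fixfree px ∘′ sym) (xs-complete x))
      T-not : ∀ b → T (not b) ⇔ (¬ T b)
      T-not false = mk⇔ (λ _ ()) (λ _ → tt)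
      T-not true  = mk⇔ (λ ()) (λ ¬t → ¬t tt)

    count-involution : count P? ≡ count (P? ∩? representative?) + count (P? ∩? representative?)
    count-involution = trans (count-split P? representative?)
      (cong (count (P? ∩? representative?) +_) (ℕₚ.≤-antisym
        (count-injection _ _ σ
          (λ (px , ¬rx) → σ-closed px , Equivalence.from (representative-σ px) ¬rx)
          (λ (px , _) (py , _) → σ-injective px py))
        (count-injection _ _ σ
          (λ (px , rx) → σ-closed px , λ rσx → Equivalence.to (representative-σ px) rσx rx)
          (λ (px , _) (py , _) → σ-injective px py))))
      where
      σ-injective : ∀ {x y} → P x → P y → σ x ≡ σ y → x ≡ y
      σ-injective {x} {y} px py σx≡σy =
        trans (sym (σ-involutive px)) (trans (cong σ σx≡σy) (σ-involutive py))

-- Classes of field elements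

-- The values 0, +1, -1 of a quadratic character.
data Class : Set where
  zero : Class
  unit : Sign → Class

infixl 7 _·_
_·_ : Class → Class → Class
zero   · _      = zero
unit s · zero   = zero
unit s · unit t = unit (s Sign.* t)

·-identityʳ : ∀ k → k · unit Sign.+ ≡ k
·-identityʳ zero     = refl
·-identityʳ (unit s) = cong unit (Signₚ.*-identityʳ s)

_≟ᶜ_ : DecidableEquality Class
zero   ≟ᶜ zero   = yes refl
zero   ≟ᶜ unit _ = no λ ()
unit _ ≟ᶜ zero   = no λ ()
unit s ≟ᶜ unit t = map′ (cong unit) (λ { refl → refl }) (s Signₚ.≟ t)

Signs : Set
Signs = Sign × Sign × Sign

opposite³ : Signs → Signs
opposite³ (s₁ , s₂ , s₃) = Sign.opposite s₁ , Sign.opposite s₂ , Sign.opposite s₃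

Match : Signs → Class → Class → Class → Set
Match (s₁ , s₂ , s₃) X Y Z = X ≡ unit s₁ × Y ≡ unit s₂ × Z ≡ unit s₃

match? : ∀ σ X Y Z → Dec (Match σ X Y Z)
match? (s₁ , s₂ , s₃) X Y Z = X ≟ᶜ unit s₁ ×-dec Y ≟ᶜ unit s₂ ×-dec Z ≟ᶜ unit s₃

Match-cong : ∀ σ {X X′ Y Y′ Z Z′} → X ≡ X′ → Y ≡ Y′ → Z ≡ Z′ → Match σ X Y Z ⇔ Match σ X′ Y′ Z′
Match-cong σ refl refl refl = ⇔.refl

⊟·k≡unit : ∀ {k s} → unit Sign.- · k ≡ unit s ⇔ k ≡ unit (Sign.opposite s)
⊟·k≡unit {zero}                 = mk⇔ (λ ()) (λ ())
⊟·k≡unit {unit Sign.+} {Sign.+} = mk⇔ (λ ()) (λ ())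
⊟·k≡unit {unit Sign.+} {Sign.-} = mk⇔ (λ _ → refl) (λ _ → refl)
⊟·k≡unit {unit Sign.-} {Sign.+} = mk⇔ (λ _ → refl) (λ _ → refl)
⊟·k≡unit {unit Sign.-} {Sign.-} = mk⇔ (λ ()) (λ ())

-- The possible values of (χ(bd), χ(ac), χ(cd), χ(ab)) for a matrix (a b; c d) of determinant 1
-- over a field where χ(-1) = unit m, according to which entry vanishes first in the order c, d, a, b.
data Pattern (m : Sign) : Class → Class → Class → Class → Set where
  zero-c      : ∀ X → Pattern m X zero zero X
  zero-d      : ∀ Y → Pattern m zero Y zero (Y · unit m)
  zero-a      : ∀ x z → x Sign.* z ≡ m → Pattern m (unit x) zero (unit z) zero
  zero-b      : ∀ z → Pattern m zero (unit z) (unit z) zero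
  all-nonzero : ∀ x y z → Pattern m (unit x) (unit y) (unit z) (unit (x Sign.* (y Sign.* z)))

zero-a′ : ∀ {m X Z} → X · Z ≡ unit m → Pattern m X zero Z zero
zero-a′ {X = zero} ()
zero-a′ {X = unit x} {zero} ()
zero-a′ {X = unit x} {unit z} refl = zero-a x z refl

zero-b′ : ∀ {m Y Z} → Y · Z ≡ unit Sign.+ → Pattern m zero Y Z zero
zero-b′ {Y = zero} ()
zero-b′ {Y = unit y} {zero} ()
zero-b′ {Y = unit Sign.+} {unit Sign.+} refl = zero-b Sign.+
zero-b′ {Y = unit Sign.-} {unit Sign.-} refl = zero-b Sign.-

all-nonzero′ : ∀ {m X Y Z} → X ≢ zero → Y ≢ zero → Z ≢ zero → Pattern m X Y Z (X · (Y · Z))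
all-nonzero′ {X = unit x} {unit y} {unit z} _ _ _ = all-nonzero x y z
all-nonzero′ {X = zero} X≢0 _ _ = ⊥-elim (X≢0 refl)
all-nonzero′ {Y = zero} _ Y≢0 _ = ⊥-elim (Y≢0 refl)
all-nonzero′ {Z = zero} _ _ Z≢0 = ⊥-elim (Z≢0 refl)

Pattern-cong : ∀ {m X X′ Y Y′ Z Z′ W W′} → X ≡ X′ → Y ≡ Y′ → Z ≡ Z′ → W ≡ W′ →
               Pattern m X′ Y′ Z′ W′ → Pattern m X Y Z W
Pattern-cong refl refl refl refl p = p

-- Membership of g in (L_s ∖ A_Ω) ∪ A_{-Ω}, when Ω is the region with signs σ, in terms of
-- the classes of g(0), g(∞) and g(∞) - g(0).
Member : Signs → Class → Class → Class → Set
Member σ X Y Z = (X ≡ unit Sign.+ × ¬ Match σ X Y Z) ⊎ Match (opposite³ σ) X Y Z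

member? : ∀ σ X Y Z → Dec (Member σ X Y Z)
member? σ X Y Z = (X ≟ᶜ unit Sign.+ ×-dec ¬? (match? σ X Y Z)) ⊎-dec match? (opposite³ σ) X Y Z

⟦_⟧ : Class → ℚ
⟦ zero ⟧        = 0ℚ
⟦ unit Sign.+ ⟧ = 1ℚ
⟦ unit Sign.- ⟧ = ℚ.- 1ℚ

𝟙 : Bool → ℚ
𝟙 true  = 1ℚ
𝟙 false = 0ℚ

𝟙-characteristic : ∀ {P Q : Set} (P? : Dec P) → Q ⇔ P → ∀ {r} → r ≡ 𝟙 (does P?) →
                   (Q → r ≡ 1ℚ) × (¬ Q → r ≡ 0ℚ)
𝟙-characteristic (yes p) Q⇔P r≡1 = (λ _ → r≡1) , (λ ¬q → ⊥-elim (¬q (Equivalence.from Q⇔P p)))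
𝟙-characteristic (no ¬p) Q⇔P r≡0 = (λ q → ⊥-elim (¬p (Equivalence.to Q⇔P q))) , (λ _ → r≡0)

record Weights : Set where
  field α β γ δ : ℚ

-- The value at g of the combination of stars with weights w (see coefficients below),
-- in terms of the classes of g(0), g(∞), -g⁻¹(∞) and -g⁻¹(0).
value : Weights → Class → Class → Class → Class → ℚ
value w X Y Z W = (𝟙 (does (X ≟ᶜ unit Sign.+)) +ℚ α *ℚ ⟦ X ⟧) +ℚ (β *ℚ ⟦ Y ⟧ +ℚ (γ *ℚ ⟦ Z ⟧ +ℚ δ *ℚ ⟦ W ⟧))
  where open Weights w

value-cong : ∀ w {X X′ Y Y′ Z Z′ W W′} → X ≡ X′ → Y ≡ Y′ → Z ≡ Z′ → W ≡ W′ →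
             value w X Y Z W ≡ value w X′ Y′ Z′ W′
value-cong w refl refl refl refl = refl

-- Finite fields

module FieldLemmas (𝔽 : FiniteField) where
  open FiniteField 𝔽

  commutativeRing : CommutativeRing 0ℓ 0ℓ
  commutativeRing = record { isCommutativeRing = isCommRing }

  open CommutativeRing commutativeRing public
    using (+-identityˡ; +-identityʳ; *-comm; *-assoc; *-identityˡ; *-identityʳ; zeroˡ; zeroʳ; -‿inverseʳ; ring)
  open import Algebra.Properties.Ring ring public using (-‿involutive; -0#≈0#)
  open IntegerRingSolver commutativeRing public using (solve; _:+_; _:*_; :-_; _:=_; con)
  open ≡-Reasoning

  x⁻¹*x≡1 : ∀ {x} → x ≢ 0# → x ⁻¹ * x ≡ 1#
  x⁻¹*x≡1 {x} x≢0 = trans (*-comm _ _) (inverseʳ x x≢0)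

  *-cancelˡ : ∀ {x y z} → x ≢ 0# → x * y ≡ x * z → y ≡ z
  *-cancelˡ {x} {y} {z} x≢0 xy≡xz = begin
    y                ≡⟨ sym (*-identityˡ y) ⟩
    1# * y           ≡⟨ cong (_* y) (sym (x⁻¹*x≡1 x≢0)) ⟩
    x ⁻¹ * x * y     ≡⟨ *-assoc _ _ _ ⟩
    x ⁻¹ * (x * y)   ≡⟨ cong (x ⁻¹ *_) xy≡xz ⟩
    x ⁻¹ * (x * z)   ≡⟨ sym (*-assoc _ _ _) ⟩
    x ⁻¹ * x * z     ≡⟨ cong (_* z) (x⁻¹*x≡1 x≢0) ⟩
    1# * z           ≡⟨ *-identityˡ z ⟩
    z                ∎

  x*y≡0⇒x≡0∨y≡0 : ∀ {x y} → x * y ≡ 0# → x ≡ 0# ⊎ y ≡ 0#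
  x*y≡0⇒x≡0∨y≡0 {x} {y} xy≡0 with x ≟ 0#
  ... | yes x≡0 = inj₁ x≡0
  ... | no  x≢0 = inj₂ (*-cancelˡ x≢0 (trans xy≡0 (sym (zeroʳ x))))

  x≡0∨y≡0⇒x*y≡0 : ∀ {x y} → x ≡ 0# ⊎ y ≡ 0# → x * y ≡ 0#
  x≡0∨y≡0⇒x*y≡0 (inj₁ refl) = zeroˡ _
  x≡0∨y≡0⇒x*y≡0 (inj₂ refl) = zeroʳ _

  x*y≢0 : ∀ {x y} → x ≢ 0# → y ≢ 0# → x * y ≢ 0#
  x*y≢0 x≢0 y≢0 xy≡0 with x*y≡0⇒x≡0∨y≡0 xy≡0
  ... | inj₁ x≡0 = x≢0 x≡0
  ... | inj₂ y≡0 = y≢0 y≡0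

  x*y≡0⇒x≡0 : ∀ {x y} → y ≢ 0# → x * y ≡ 0# → x ≡ 0#
  x*y≡0⇒x≡0 y≢0 xy≡0 with x*y≡0⇒x≡0∨y≡0 xy≡0
  ... | inj₁ x≡0 = x≡0
  ... | inj₂ y≡0 = ⊥-elim (y≢0 y≡0)

  1≢0 : 1# ≢ 0#
  1≢0 = 0≢1 ∘ sym

  ⁻¹≢0 : ∀ {x} → x ≢ 0# → x ⁻¹ ≢ 0#
  ⁻¹≢0 {x} x≢0 x⁻¹≡0 = 1≢0 (trans (sym (inverseʳ x x≢0)) (trans (cong (x *_) x⁻¹≡0) (zeroʳ x)))

  ⁻¹-involutive : ∀ {x} → x ≢ 0# → x ⁻¹ ⁻¹ ≡ x
  ⁻¹-involutive {x} x≢0 = *-cancelˡ (⁻¹≢0 x≢0) (trans (inverseʳ _ (⁻¹≢0 x≢0)) (sym (x⁻¹*x≡1 x≢0)))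

  -x≢0 : ∀ {x} → x ≢ 0# → - x ≢ 0#
  -x≢0 {x} x≢0 -x≡0 = x≢0 (trans (sym (-‿involutive x)) (trans (cong -_ -x≡0) -0#≈0#))

  x-y≡0⇒x≡y : ∀ {x y} → x + - y ≡ 0# → x ≡ y
  x-y≡0⇒x≡y {x} {y} x-y≡0 = begin
    x             ≡⟨ solve 2 (λ x y → x := (x :+ :- y) :+ y) refl x y ⟩
    (x + - y) + y ≡⟨ cong (_+ y) x-y≡0 ⟩
    0# + y        ≡⟨ +-identityˡ y ⟩
    y             ∎

  x*x≡y*y⇒x≡±y : ∀ {x y} → x * x ≡ y * y → x ≡ y ⊎ x ≡ - y
  x*x≡y*y⇒x≡±y {x} {y} x²≡y² with x*y≡0⇒x≡0∨y≡0 (x-y*x+y≡0)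
    where
    x-y*x+y≡0 : (x + - y) * (x + y) ≡ 0#
    x-y*x+y≡0 = begin
      (x + - y) * (x + y) ≡⟨ solve 2 (λ x y → (x :+ :- y) :* (x :+ y) := x :* x :+ :- (y :* y)) refl x y ⟩
      x * x + - (y * y)   ≡⟨ cong (_+ - (y * y)) x²≡y² ⟩
      y * y + - (y * y)   ≡⟨ -‿inverseʳ _ ⟩
      0#                  ∎
  ... | inj₁ x-y≡0 = inj₁ (x-y≡0⇒x≡y x-y≡0)
  ... | inj₂ x+y≡0 = inj₂ (x-y≡0⇒x≡y (trans (cong (x +_) (-‿involutive y)) x+y≡0))

  linear-root : ∀ {c d u} → c ≢ 0# → c * u + d ≡ 0# ⇔ u ≡ - d * c ⁻¹
  linear-root {c} {d} {u} c≢0 = mk⇔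
    (λ cu+d≡0 → *-cancelˡ c≢0 (begin
      c * u                        ≡⟨ solve 3 (λ c u d → c :* u := (c :* u :+ d) :+ :- d) refl c u d ⟩
      (c * u + d) + - d            ≡⟨ cong (_+ - d) cu+d≡0 ⟩
      0# + - d                     ≡⟨ +-identityˡ _ ⟩
      - d                          ≡⟨ sym (*-identityʳ _) ⟩
      - d * 1#                     ≡⟨ cong (- d *_) (sym (inverseʳ c c≢0)) ⟩
      - d * (c * c ⁻¹)             ≡⟨ solve 3 (λ c d c′ → :- d :* (c :* c′) := c :* (:- d :* c′)) refl c d (c ⁻¹) ⟩
      c * (- d * c ⁻¹)             ∎))
    (λ { refl → begin
      c * (- d * c ⁻¹) + d         ≡⟨ solve 3 (λ c d c′ → c :* (:- d :* c′) :+ d := :- d :* (c :* c′) :+ d) refl c d (c ⁻¹) ⟩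
      - d * (c * c ⁻¹) + d         ≡⟨ cong (λ t → - d * t + d) (inverseʳ c c≢0) ⟩
      - d * 1# + d                 ≡⟨ solve 1 (λ d → :- d :* con (ℤ.+ 1) :+ d := con (ℤ.+ 0)) refl d ⟩
      0#                           ∎ })

module QuadraticCharacter (𝔽 : FiniteField) where
  open FiniteField 𝔽
  open Over 𝔽 using (IsSquare; IsNonSquare)
  open FieldLemmas 𝔽
  open ≡-Reasoning

  HasRoot : F → Set
  HasRoot x = ∃ λ y → y * y ≡ x

  hasRoot? : Decidable HasRoot
  hasRoot? x = map′ Any.satisfied (λ (y , y²≡x) → Any.map (λ { refl → y²≡x }) (complete y))
                    (Any.any? (λ y → (y * y) ≟ x) elements)

  hasRoot-* : ∀ {x y} → HasRoot x → HasRoot y → HasRoot (x * y)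
  hasRoot-* (r , refl) (s , refl) = r * s , solve 2 (λ r s → (r :* s) :* (r :* s) := (r :* r) :* (s :* s)) refl r s

  hasRoot-÷ : ∀ {x y} → x ≢ 0# → HasRoot x → HasRoot (x * y) → HasRoot y
  hasRoot-÷ {y = y} x≢0 (r , refl) (s , s²≡r²y) = s * r ⁻¹ , (begin
    s * r ⁻¹ * (s * r ⁻¹)
      ≡⟨ solve 2 (λ s r′ → s :* r′ :* (s :* r′) := (s :* s) :* (r′ :* r′)) refl s (r ⁻¹) ⟩
    s * s * (r ⁻¹ * r ⁻¹)
      ≡⟨ cong (_* (r ⁻¹ * r ⁻¹)) s²≡r²y ⟩
    r * r * y * (r ⁻¹ * r ⁻¹)
      ≡⟨ solve 3 (λ r y r′ → r :* r :* y :* (r′ :* r′) := (r :* r′) :* (r :* r′) :* y) refl r y (r ⁻¹) ⟩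
    (r * r ⁻¹) * (r * r ⁻¹) * y
      ≡⟨ cong (λ t → t * t * y) (inverseʳ r r≢0) ⟩
    1# * 1# * y
      ≡⟨ solve 1 (λ y → con (ℤ.+ 1) :* con (ℤ.+ 1) :* y := y) refl y ⟩
    y ∎)
    where
    r≢0 : r ≢ 0#
    r≢0 r≡0 = x≢0 (trans (cong (λ t → t * t) r≡0) (zeroʳ 0#))

  χ : F → Class
  χ x with x ≟ 0# | hasRoot? x
  ... | yes _ | _     = zero
  ... | no _  | yes _ = unit Sign.+
  ... | no _  | no _  = unit Sign.-

  data HasClass (x : F) : Class → Set where
    zero      : x ≡ 0# → HasClass x zero
    square    : IsSquare x → HasClass x (unit Sign.+)
    nonsquare : IsNonSquare x → HasClass x (unit Sign.-)

  hasClass-χ : ∀ x → HasClass x (χ x)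
  hasClass-χ x with x ≟ 0# | hasRoot? x
  ... | yes x≡0 | _         = zero x≡0
  ... | no x≢0  | yes root  = square (x≢0 , root)
  ... | no x≢0  | no ¬root  = nonsquare (x≢0 , ¬root)

  hasClass-unique : ∀ {x k l} → HasClass x k → HasClass x l → k ≡ l
  hasClass-unique (zero _)              (zero _)              = refl
  hasClass-unique (zero x≡0)            (square (x≢0 , _))    = ⊥-elim (x≢0 x≡0)
  hasClass-unique (zero x≡0)            (nonsquare (x≢0 , _)) = ⊥-elim (x≢0 x≡0)
  hasClass-unique (square (x≢0 , _))    (zero x≡0)            = ⊥-elim (x≢0 x≡0)
  hasClass-unique (square _)            (square _)            = refl
  hasClass-unique (square (_ , r))      (nonsquare (_ , ¬r))  = ⊥-elim (¬r r)
  hasClass-unique (nonsquare (x≢0 , _)) (zero x≡0)            = ⊥-elim (x≢0 x≡0)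
  hasClass-unique (nonsquare (_ , ¬r))  (square (_ , r))      = ⊥-elim (¬r r)
  hasClass-unique (nonsquare _)         (nonsquare _)         = refl

  χ-≡ : ∀ {x k} → HasClass x k → χ x ≡ k
  χ-≡ = hasClass-unique (hasClass-χ _)

  χ≡⇒hasClass : ∀ {x k} → χ x ≡ k → HasClass x k
  χ≡⇒hasClass {x} refl = hasClass-χ x

  χ-0 : χ 0# ≡ zero
  χ-0 = χ-≡ (zero refl)

  χ-1 : χ 1# ≡ unit Sign.+
  χ-1 = χ-≡ (square (1≢0 , 1# , *-identityˡ 1#))

  χ-≢0 : ∀ {x} → x ≢ 0# → χ x ≢ zero
  χ-≢0 x≢0 χx≡0 with χ≡⇒hasClass χx≡0
  ... | zero x≡0 = x≢0 x≡0

  square⇔χ≡+ : ∀ {x} → IsSquare x ⇔ χ x ≡ unit Sign.+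
  square⇔χ≡+ = mk⇔ (χ-≡ ∘ square) λ χx≡+ → case χ≡⇒hasClass χx≡+ of λ { (square x□) → x□ }

  nonsquare⇔χ≡- : ∀ {x} → IsNonSquare x ⇔ χ x ≡ unit Sign.-
  nonsquare⇔χ≡- = mk⇔ (χ-≡ ∘ nonsquare) λ χx≡- → case χ≡⇒hasClass χx≡- of λ { (nonsquare x⊠) → x⊠ }

  χ-zeroˡ : ∀ {x y} → x ≡ 0# → χ (x * y) ≡ zero
  χ-zeroˡ refl = trans (cong χ (zeroˡ _)) χ-0

  χ-zeroʳ : ∀ {x y} → y ≡ 0# → χ (x * y) ≡ zero
  χ-zeroʳ refl = trans (cong χ (zeroʳ _)) χ-0

  square*nonsquare : ∀ {x y} → IsSquare x → IsNonSquare y → IsNonSquare (x * y)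
  square*nonsquare (x≢0 , x-root) (y≢0 , ¬y-root) = x*y≢0 x≢0 y≢0 , ¬y-root ∘ hasRoot-÷ x≢0 x-root

  isSquare? : Decidable IsSquare
  isSquare? = ∁? (_≟ 0#) ∩? hasRoot?

  isNonSquare? : Decidable IsNonSquare
  isNonSquare? = ∁? (_≟ 0#) ∩? ∁? hasRoot?

  open Counting _≟_ elements unique complete

  #squares #nonsquares : ℕ
  #squares    = count isSquare?
  #nonsquares = count isNonSquare?

  order≡1+#squares+#nonsquares : order ≡ 1 ℕ.+ (#squares ℕ.+ #nonsquares)
  order≡1+#squares+#nonsquares = begin
    order
      ≡⟨ count-partition (_≟ 0#) ⟩
    count (_≟ 0#) ℕ.+ count (∁? (_≟ 0#))
      ≡⟨ cong₂ ℕ._+_ (count-singleton (_≟ 0#) refl id) (count-split (∁? (_≟ 0#)) hasRoot?) ⟩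
    1 ℕ.+ (#squares ℕ.+ #nonsquares) ∎

  module OddCharacteristic {ζ} (ζ-nonsquare : IsNonSquare ζ) where

    -- in characteristic 2 squaring would be injective, hence onto, leaving no room for ζ
    1+1≢0 : 1# + 1# ≢ 0#
    1+1≢0 2≡0 = ℕₚ.<-irrefl refl
      (count-injection-missing (λ _ → yes tt) (λ _ → yes tt) (λ x → x * x) _ square-injective _
         (λ _ x²≡ζ → proj₂ ζ-nonsquare (_ , x²≡ζ)))
      where
      -y≡y : ∀ y → - y ≡ y
      -y≡y y = sym (x-y≡0⇒x≡y (begin
        y + - - y       ≡⟨ solve 1 (λ y → y :+ :- :- y := (con (ℤ.+ 1) :+ con (ℤ.+ 1)) :* y) refl y ⟩
        (1# + 1#) * y   ≡⟨ cong (_* y) 2≡0 ⟩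
        0# * y          ≡⟨ zeroˡ y ⟩
        0#              ∎))
      square-injective : ∀ {x y} → ⊤ → ⊤ → x * x ≡ y * y → x ≡ y
      square-injective {y = y} _ _ x²≡y² with x*x≡y*y⇒x≡±y x²≡y²
      ... | inj₁ x≡y  = x≡y
      ... | inj₂ x≡-y = trans x≡-y (-y≡y y)

    x≢-x : ∀ {x} → x ≢ 0# → x ≢ - x
    x≢-x {x} x≢0 x≡-x = x≢0 (*-cancelˡ 1+1≢0 (begin
      (1# + 1#) * x ≡⟨ solve 1 (λ x → (con (ℤ.+ 1) :+ con (ℤ.+ 1)) :* x := x :+ x) refl x ⟩
      x + x         ≡⟨ cong (x +_) x≡-x ⟩
      x + - x       ≡⟨ -‿inverseʳ x ⟩
      0#            ≡⟨ sym (zeroʳ _) ⟩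
      (1# + 1#) * 0# ∎))

    -- the nonzero elements fall into pairs {x, -x} with a common square
    #nonsquares≤#squares : #nonsquares ℕ.≤ #squares
    #nonsquares≤#squares = ℕₚ.+-cancelˡ-≤ #squares #nonsquares #squares
      (subst (ℕ._≤ #squares ℕ.+ #squares) (trans (sym count-involution) (count-split (∁? (_≟ 0#)) hasRoot?))
        (ℕₚ.+-mono-≤ #pairs≤#squares #pairs≤#squares))
      where
      open Involution (∁? (_≟ 0#)) -_ (λ _ → -‿involutive _) -x≢0 (λ x≢0 -x≡x → x≢-x x≢0 (sym -x≡x))
      #pairs : ℕ
      #pairs = count (∁? (_≟ 0#) ∩? representative?)
      #pairs≤#squares : #pairs ℕ.≤ #squares
      #pairs≤#squares = count-injection _ isSquare? (λ x → x * x)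
        (λ (x≢0 , _) → x*y≢0 x≢0 x≢0 , _ , refl) square-injective
        where
        square-injective : ∀ {x y} → _ → _ → x * x ≡ y * y → x ≡ y
        square-injective (x≢0 , rx) (y≢0 , ry) x²≡y² with x*x≡y*y⇒x≡±y x²≡y²
        ... | inj₁ x≡y      = x≡y
        ... | inj₂ refl = ⊥-elim (Equivalence.to (representative-σ y≢0) rx ry)

    #squares≤#nonsquares : #squares ℕ.≤ #nonsquares
    #squares≤#nonsquares = count-injection isSquare? isNonSquare? (ζ *_)
      (λ x-square → subst IsNonSquare (*-comm _ _) (square*nonsquare x-square ζ-nonsquare))
      (λ _ _ → *-cancelˡ (proj₁ ζ-nonsquare))

    nonsquare*nonsquare : ∀ {x y} → IsNonSquare x → IsNonSquare y → IsSquare (x * y)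
    nonsquare*nonsquare {x} {y} x-nonsquare@(x≢0 , _) y-nonsquare@(y≢0 , ¬y-root) with hasRoot? (x * y)
    ... | yes xy-root = x*y≢0 x≢0 y≢0 , xy-root
    ... | no ¬xy-root = ⊥-elim (ℕₚ.<-irrefl refl (ℕₚ.≤-trans
          (count-injection-missing isSquare? isNonSquare? (x *_)
            (λ z-square → subst IsNonSquare (*-comm _ _) (square*nonsquare z-square x-nonsquare))
            (λ _ _ → *-cancelˡ x≢0)
            (x*y≢0 x≢0 y≢0 , ¬xy-root)
            (λ (_ , z-root) xz≡xy → ¬y-root (subst HasRoot (*-cancelˡ x≢0 xz≡xy) z-root)))
          #nonsquares≤#squares))

    hasClass-* : ∀ {x y k l} → HasClass x k → HasClass y l → HasClass (x * y) (k · l)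
    hasClass-* (zero refl)     _               = zero (zeroˡ _)
    hasClass-* (square _)      (zero refl)     = zero (zeroʳ _)
    hasClass-* (nonsquare _)   (zero refl)     = zero (zeroʳ _)
    hasClass-* (square (x≢0 , x-root)) (square (y≢0 , y-root)) = square (x*y≢0 x≢0 y≢0 , hasRoot-* x-root y-root)
    hasClass-* (square x□)     (nonsquare y⊠)  = nonsquare (square*nonsquare x□ y⊠)
    hasClass-* (nonsquare x⊠)  (square y□)     = nonsquare (subst IsNonSquare (*-comm _ _) (square*nonsquare y□ x⊠))
    hasClass-* (nonsquare x⊠)  (nonsquare y⊠)  = square (nonsquare*nonsquare x⊠ y⊠)

    χ-* : ∀ x y → χ (x * y) ≡ χ x · χ y
    χ-* x y = χ-≡ (hasClass-* (hasClass-χ x) (hasClass-χ y))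

    χ-*-square : ∀ x {y} → y ≢ 0# → χ (x * (y * y)) ≡ χ x
    χ-*-square x {y} y≢0 = begin
      χ (x * (y * y))     ≡⟨ χ-* x (y * y) ⟩
      χ x · χ (y * y)     ≡⟨ cong (χ x ·_) (χ-≡ (square (x*y≢0 y≢0 y≢0 , y , refl))) ⟩
      χ x · unit Sign.+   ≡⟨ ·-identityʳ (χ x) ⟩
      χ x                 ∎

    χ-⁻¹ : ∀ {x} → x ≢ 0# → χ (x ⁻¹) ≡ χ x
    χ-⁻¹ {x} x≢0 = trans (cong χ x⁻¹≡x*x⁻¹²) (χ-*-square x (⁻¹≢0 x≢0))
      where
      x⁻¹≡x*x⁻¹² : x ⁻¹ ≡ x * (x ⁻¹ * x ⁻¹)
      x⁻¹≡x*x⁻¹² = sym (trans (sym (*-assoc _ _ _)) (trans (cong (_* x ⁻¹) (inverseʳ x x≢0)) (*-identityˡ _)))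

    χ-÷ : ∀ x {y} → y ≢ 0# → χ (x * y ⁻¹) ≡ χ (x * y)
    χ-÷ x {y} y≢0 = begin
      χ (x * y ⁻¹)                         ≡⟨ χ-* x (y ⁻¹) ⟩
      χ x · χ (y ⁻¹)                       ≡⟨ cong (χ x ·_) (χ-⁻¹ y≢0) ⟩
      χ x · χ y                            ≡⟨ sym (χ-* x y) ⟩
      χ (x * y)                            ∎

    order≡1+2#squares : order ≡ 1 ℕ.+ (#squares ℕ.+ #squares)
    order≡1+2#squares = trans order≡1+#squares+#nonsquares
      (cong (λ n → 1 ℕ.+ (#squares ℕ.+ n)) (ℕₚ.≤-antisym #nonsquares≤#squares #squares≤#nonsquares))

    order%4≡[1+2r]%4 : ∀ r k → #squares ≡ r ℕ.+ (k ℕ.+ k) → order ℕ.% 4 ≡ (1 ℕ.+ (r ℕ.+ r)) ℕ.% 4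
    order%4≡[1+2r]%4 r k #squares≡r+2k = begin
      order ℕ.% 4
        ≡⟨ cong (ℕ._% 4) (trans order≡1+2#squares (cong (λ n → 1 ℕ.+ (n ℕ.+ n)) #squares≡r+2k)) ⟩
      (1 ℕ.+ (r ℕ.+ (k ℕ.+ k) ℕ.+ (r ℕ.+ (k ℕ.+ k)))) ℕ.% 4
        ≡⟨ cong (ℕ._% 4) (arithmetic r k) ⟩
      (1 ℕ.+ (r ℕ.+ r) ℕ.+ k ℕ.* 4) ℕ.% 4
        ≡⟨ [m+kn]%n≡m%n (1 ℕ.+ (r ℕ.+ r)) k 4 ⟩
      (1 ℕ.+ (r ℕ.+ r)) ℕ.% 4 ∎
      where
      arithmetic : ∀ r k → 1 ℕ.+ (r ℕ.+ (k ℕ.+ k) ℕ.+ (r ℕ.+ (k ℕ.+ k))) ≡ 1 ℕ.+ (r ℕ.+ r) ℕ.+ k ℕ.* 4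
      arithmetic = ℕ-solve-∀

    -- if -1 is a square, x ↦ -x pairs off the squares
    χ[-1]≡+⇒order%4≡1 : χ (- 1#) ≡ unit Sign.+ → order ℕ.% 4 ≡ 1
    χ[-1]≡+⇒order%4≡1 χ[-1]≡+ = order%4≡[1+2r]%4 0 (count (isSquare? ∩? representative?)) count-involution
      where
      -x-square : ∀ {x} → IsSquare x → IsSquare (- x)
      -x-square {x} x□ = Equivalence.from square⇔χ≡+ (begin
        χ (- x)                     ≡⟨ cong χ (solve 1 (λ x → :- x := :- con (ℤ.+ 1) :* x) refl x) ⟩
        χ (- 1# * x)                ≡⟨ χ-* (- 1#) x ⟩
        χ (- 1#) · χ x              ≡⟨ cong₂ _·_ χ[-1]≡+ (Equivalence.to square⇔χ≡+ x□) ⟩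
        unit Sign.+                 ∎)
      open Involution isSquare? -_ (λ _ → -‿involutive _) -x-square (λ (x≢0 , _) -x≡x → x≢-x x≢0 (sym -x≡x))

    -- if -1 is not a square, x ↦ x⁻¹ pairs off the squares other than 1
    χ[-1]≡-⇒order%4≡3 : χ (- 1#) ≡ unit Sign.- → order ℕ.% 4 ≡ 3
    χ[-1]≡-⇒order%4≡3 χ[-1]≡- = order%4≡[1+2r]%4 1 #pairs (trans (count-split isSquare? (_≟ 1#))
      (cong₂ ℕ._+_ (count-singleton (isSquare? ∩? (_≟ 1#)) (1-square , refl) proj₂) count-involution))
      where
      1-square : IsSquare 1#
      1-square = 1≢0 , 1# , *-identityˡ 1#
      1⁻¹≡1 : 1# ⁻¹ ≡ 1#
      1⁻¹≡1 = trans (sym (*-identityˡ _)) (inverseʳ 1# 1≢0)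
      ⁻¹-closed : ∀ {x} → IsSquare x × x ≢ 1# → IsSquare (x ⁻¹) × x ⁻¹ ≢ 1#
      ⁻¹-closed {x} (x□@(x≢0 , _) , x≢1) =
        Equivalence.from square⇔χ≡+ (trans (χ-⁻¹ x≢0) (Equivalence.to square⇔χ≡+ x□)) ,
        λ x⁻¹≡1 → x≢1 (trans (sym (⁻¹-involutive x≢0)) (trans (cong _⁻¹ x⁻¹≡1) 1⁻¹≡1))
      ⁻¹-fixfree : ∀ {x} → IsSquare x × x ≢ 1# → x ⁻¹ ≢ x
      ⁻¹-fixfree {x} (x□@(x≢0 , _) , x≢1) x⁻¹≡x
        with x*x≡y*y⇒x≡±y (trans (cong (x *_) (sym x⁻¹≡x)) (trans (inverseʳ x x≢0) (sym (*-identityˡ 1#))))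
      ... | inj₁ x≡1  = x≢1 x≡1
      ... | inj₂ refl with trans (sym χ[-1]≡-) (Equivalence.to square⇔χ≡+ x□)
      ...   | ()
      open Involution (isSquare? ∩? ∁? (_≟ 1#)) _⁻¹ (λ ((x≢0 , _) , _) → ⁻¹-involutive x≢0) ⁻¹-closed ⁻¹-fixfree
      #pairs : ℕ
      #pairs = count ((isSquare? ∩? ∁? (_≟ 1#)) ∩? representative?)

    order%4≡3⇒χ[-1]≡- : order ℕ.% 4 ≡ 3 → χ (- 1#) ≡ unit Sign.-
    order%4≡3⇒χ[-1]≡- q%4≡3 = by-class (χ (- 1#)) refl
      where
      by-class : ∀ k → χ (- 1#) ≡ k → χ (- 1#) ≡ unit Sign.-
      by-class zero          χ[-1]≡0 = ⊥-elim (χ-≢0 (-x≢0 1≢0) χ[-1]≡0)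
      by-class (unit Sign.-) χ[-1]≡- = χ[-1]≡-
      by-class (unit Sign.+) χ[-1]≡+ = ⊥-elim (3≢1 (trans (sym q%4≡3) (χ[-1]≡+⇒order%4≡1 χ[-1]≡+)))
        where 3≢1 : 3 ≢ 1
              3≢1 ()

    order%4≡1⇒χ[-1]≡+ : order ℕ.% 4 ≡ 1 → χ (- 1#) ≡ unit Sign.+
    order%4≡1⇒χ[-1]≡+ q%4≡1 = by-class (χ (- 1#)) refl
      where
      by-class : ∀ k → χ (- 1#) ≡ k → χ (- 1#) ≡ unit Sign.+
      by-class zero          χ[-1]≡0 = ⊥-elim (χ-≢0 (-x≢0 1≢0) χ[-1]≡0)
      by-class (unit Sign.+) χ[-1]≡+ = χ[-1]≡+
      by-class (unit Sign.-) χ[-1]≡- = ⊥-elim (1≢3 (trans (sym q%4≡1) (χ[-1]≡-⇒order%4≡3 χ[-1]≡-)))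
        where 1≢3 : 1 ≢ 3
              1≢3 ()

-- Combinations of stars

module StarCombinations (𝔽 : FiniteField) where
  open FiniteField 𝔽
  open Over 𝔽
  open import Algebra.Properties.CommutativeSemigroup (CommutativeMonoid.commutativeSemigroup ℚₚ.+-0-commutativeMonoid)
    using (interchange)

  P1-unique : Unique P1-elements
  P1-unique = All.map⁺ (All.universal (λ _ ()) elements) ∷ Unique.map⁺ (λ { refl → refl }) unique

  P1-complete : ∀ x → x ∈ P1-elements
  P1-complete ∞      = here refl
  P1-complete (pt x) = there (∈-map⁺ pt (complete x))

  sumℚ-map-zero : ∀ (f : P1 → ℚ) {xs} → All (λ x → f x ≡ 0ℚ) xs → sumℚ (map f xs) ≡ 0ℚ
  sumℚ-map-zero f []         = refl
  sumℚ-map-zero f (fx≡0 ∷ fxs≡0) = trans (cong₂ _+ℚ_ fx≡0 (sumℚ-map-zero f fxs≡0)) (ℚₚ.+-identityˡ 0ℚ)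

  sumℚ-pick : ∀ (f : P1 → ℚ) p → (∀ {x} → x ≢ p → f x ≡ 0ℚ) → sumℚ (map f P1-elements) ≡ f p
  sumℚ-pick f p f≡0 = go P1-unique (P1-complete p)
    where
    go : ∀ {xs} → Unique xs → p ∈ xs → sumℚ (map f xs) ≡ f p
    go (p∉xs ∷ _)   (here refl)  =
      trans (cong (f p +ℚ_) (sumℚ-map-zero f (All.map (λ p≢x → f≡0 (p≢x ∘ sym)) p∉xs))) (ℚₚ.+-identityʳ _)
    go (x∉xs ∷ xs!) (there p∈xs) =
      trans (cong₂ _+ℚ_ (f≡0 (λ { refl → All.lookup x∉xs p∈xs refl })) (go xs! p∈xs)) (ℚₚ.+-identityˡ _)

  sumℚ-map-+ : ∀ (f h : P1 → ℚ) xs → sumℚ (map (λ x → f x +ℚ h x) xs) ≡ sumℚ (map f xs) +ℚ sumℚ (map h xs)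
  sumℚ-map-+ f h []       = sym (ℚₚ.+-identityˡ 0ℚ)
  sumℚ-map-+ f h (x ∷ xs) = trans (cong (f x +ℚ h x +ℚ_) (sumℚ-map-+ f h xs)) (interchange (f x) (h x) _ _)

  star-≡ : ∀ x g → star x (act g x) g ≡ 1ℚ
  star-≡ x g with act g x ≟P act g x
  ... | yes _   = refl
  ... | no ≢gx = ⊥-elim (≢gx refl)

  star-≢ : ∀ {x y g} → act g x ≢ y → star x y g ≡ 0ℚ
  star-≢ {x} {y} {g} gx≢y with act g x ≟P y
  ... | yes gx≡y = ⊥-elim (gx≢y gx≡y)
  ... | no _     = refl

  combo-eval : ∀ coef g → combo coef g ≡ sumℚ (map (λ x → coef x (act g x)) P1-elements)
  combo-eval coef g = cong sumℚ (map-cong row P1-elements)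
    where
    row : ∀ x → sumℚ (map (λ y → coef x y *ℚ star x y g) P1-elements) ≡ coef x (act g x)
    row x = trans (sumℚ-pick (λ y → coef x y *ℚ star x y g) (act g x)
                    (λ {y} y≢gx → trans (cong (coef x y *ℚ_) (star-≢ {x} {y} {g} (y≢gx ∘ sym))) (ℚₚ.*-zeroʳ (coef x y))))
                  (trans (cong (coef x (act g x) *ℚ_) (star-≡ x g)) (ℚₚ.*-identityʳ _))

  indicator : P1 → P1 → ℚ
  indicator p x with x ≟P p
  ... | yes _ = 1ℚ
  ... | no _  = 0ℚ

  indicator-≡ : ∀ p → indicator p p ≡ 1ℚ
  indicator-≡ p with p ≟P p
  ... | yes _  = refl
  ... | no p≢p = ⊥-elim (p≢p refl)

  indicator-≢ : ∀ {p x} → x ≢ p → indicator p x ≡ 0ℚ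
  indicator-≢ {p} {x} x≢p with x ≟P p
  ... | yes x≡p = ⊥-elim (x≢p x≡p)
  ... | no _    = refl

  sum-indicator-source : ∀ p (K : P1 → ℚ) g →
    sumℚ (map (λ x → indicator p x *ℚ K (act g x)) P1-elements) ≡ K (act g p)
  sum-indicator-source p K g =
    trans (sumℚ-pick _ p (λ {x} x≢p → trans (cong (_*ℚ K (act g x)) (indicator-≢ x≢p)) (ℚₚ.*-zeroˡ (K (act g x)))))
          (trans (cong (_*ℚ K (act g p)) (indicator-≡ p)) (ℚₚ.*-identityˡ _))

  UniquePreimage : SL2 → P1 → P1 → Set
  UniquePreimage g p r = act g r ≡ p × (∀ {x} → act g x ≡ p → x ≡ r)

  sum-indicator-target : ∀ {g p r} (Z : P1 → ℚ) → UniquePreimage g p r →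
    sumℚ (map (λ x → indicator p (act g x) *ℚ Z x) P1-elements) ≡ Z r
  sum-indicator-target {g} {p} {r} Z (gr≡p , unique-r) =
    trans (sumℚ-pick _ r (λ {x} x≢r → trans (cong (_*ℚ Z x) (indicator-≢ (x≢r ∘ unique-r))) (ℚₚ.*-zeroˡ (Z x))))
          (trans (cong (λ q → indicator p q *ℚ Z r) gr≡p) (trans (cong (_*ℚ Z r) (indicator-≡ p)) (ℚₚ.*-identityˡ _)))

  -- the coefficients supported on the stars from 0, from ∞, to ∞ and to 0
  fourStars : (K₀ K∞ Z∞ Z₀ : P1 → ℚ) → P1 → P1 → ℚ
  fourStars K₀ K∞ Z∞ Z₀ x y =
    indicator (pt 0#) x *ℚ K₀ y +ℚ (indicator ∞ x *ℚ K∞ y +ℚ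
      (indicator ∞ y *ℚ Z∞ x +ℚ indicator (pt 0#) y *ℚ Z₀ x))

  combo-fourStars : ∀ K₀ K∞ Z∞ Z₀ {g r∞ r₀} → UniquePreimage g ∞ r∞ → UniquePreimage g (pt 0#) r₀ →
    combo (fourStars K₀ K∞ Z∞ Z₀) g ≡ K₀ (act g (pt 0#)) +ℚ (K∞ (act g ∞) +ℚ (Z∞ r∞ +ℚ Z₀ r₀))
  combo-fourStars K₀ K∞ Z∞ Z₀ {g} r∞-preimage r₀-preimage = begin
    combo (fourStars K₀ K∞ Z∞ Z₀) g
      ≡⟨ combo-eval (fourStars K₀ K∞ Z∞ Z₀) g ⟩
    ∑ (λ x → from₀ x +ℚ (from∞ x +ℚ (to∞ x +ℚ to₀ x)))
      ≡⟨ sumℚ-map-+ from₀ _ P1-elements ⟩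
    ∑ from₀ +ℚ ∑ (λ x → from∞ x +ℚ (to∞ x +ℚ to₀ x))
      ≡⟨ cong (∑ from₀ +ℚ_) (sumℚ-map-+ from∞ _ P1-elements) ⟩
    ∑ from₀ +ℚ (∑ from∞ +ℚ ∑ (λ x → to∞ x +ℚ to₀ x))
      ≡⟨ cong (λ s → ∑ from₀ +ℚ (∑ from∞ +ℚ s)) (sumℚ-map-+ to∞ to₀ P1-elements) ⟩
    ∑ from₀ +ℚ (∑ from∞ +ℚ (∑ to∞ +ℚ ∑ to₀))
      ≡⟨ cong₂ _+ℚ_ (sum-indicator-source (pt 0#) K₀ g) (cong₂ _+ℚ_ (sum-indicator-source ∞ K∞ g)
           (cong₂ _+ℚ_ (sum-indicator-target Z∞ r∞-preimage) (sum-indicator-target Z₀ r₀-preimage))) ⟩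
    K₀ (act g (pt 0#)) +ℚ (K∞ (act g ∞) +ℚ (Z∞ _ +ℚ Z₀ _)) ∎
    where
    open ≡-Reasoning
    ∑ : (P1 → ℚ) → ℚ
    ∑ f = sumℚ (map f P1-elements)
    from₀ from∞ to∞ to₀ : P1 → ℚ
    from₀ x = indicator (pt 0#) x *ℚ K₀ (act g x)
    from∞ x = indicator ∞ x *ℚ K∞ (act g x)
    to∞ x   = indicator ∞ (act g x) *ℚ Z∞ x
    to₀ x   = indicator (pt 0#) (act g x) *ℚ Z₀ x

-- The action of SL(2,q) on the projective line

module ProjectiveAction (𝔽 : FiniteField) {ζ} (ζ-nonsquare : Over.IsNonSquare 𝔽 ζ) where
  open FiniteField 𝔽
  open Over 𝔽
  open FieldLemmas 𝔽
  open QuadraticCharacter 𝔽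
  open OddCharacteristic ζ-nonsquare
  open StarCombinations 𝔽 using (UniquePreimage; fourStars; combo-fourStars)
  open ≡-Reasoning

  frac : F → F → P1
  frac x y with y ≟ 0#
  ... | yes _ = ∞
  ... | no _  = pt (x * y ⁻¹)

  frac-∞ : ∀ {x y} → y ≡ 0# → frac x y ≡ ∞
  frac-∞ {y = y} y≡0 with y ≟ 0#
  ... | yes _   = refl
  ... | no y≢0 = ⊥-elim (y≢0 y≡0)

  frac-pt : ∀ {x y} → y ≢ 0# → frac x y ≡ pt (x * y ⁻¹)
  frac-pt {y = y} y≢0 with y ≟ 0#
  ... | yes y≡0 = ⊥-elim (y≢0 y≡0)
  ... | no _    = refl

  frac≡∞⇒ : ∀ {x y} → frac x y ≡ ∞ → y ≡ 0#
  frac≡∞⇒ {y = y} eq with y ≟ 0#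
  ... | yes y≡0 = y≡0

  frac≡pt⇒ : ∀ {x y z} → frac x y ≡ pt z → y ≢ 0# × x * y ⁻¹ ≡ z
  frac≡pt⇒ {y = y} eq with y ≟ 0#
  ... | no y≢0 = y≢0 , pt-injective eq
    where pt-injective : ∀ {u v} → pt u ≡ pt v → u ≡ v
          pt-injective refl = refl

  root-is-frac : ∀ {r s u} → (r ≡ 0# → s ≢ 0#) → r * u + s ≡ 0# → pt u ≡ frac (- s) r
  root-is-frac {r} {s} {u} r≡0⇒s≢0 ru+s≡0 with r ≟ 0#
  ... | yes r≡0 = ⊥-elim (r≡0⇒s≢0 r≡0 (begin
    s           ≡⟨ sym (+-identityˡ s) ⟩
    0# + s      ≡⟨ cong (_+ s) (sym (zeroˡ u)) ⟩
    0# * u + s  ≡⟨ cong (λ t → t * u + s) (sym r≡0) ⟩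
    r * u + s   ≡⟨ ru+s≡0 ⟩
    0#          ∎))
  ... | no r≢0  = cong pt (Equivalence.to (linear-root r≢0) ru+s≡0)

  χᴾ : P1 → Class
  χᴾ (pt x) = χ x
  χᴾ ∞      = zero

  χᴾ-frac : ∀ x y → χᴾ (frac x y) ≡ χ (x * y)
  χᴾ-frac x y with y ≟ 0#
  ... | yes y≡0 = sym (trans (cong (λ t → χ (x * t)) y≡0) (trans (cong χ (zeroʳ x)) χ-0))
  ... | no y≢0  = χ-÷ x y≢0

  scale-frac : ∀ z x y → scale z (frac x y) ≡ frac (z * x) y
  scale-frac z x y with y ≟ 0#
  ... | yes _ = refl
  ... | no _  = cong pt (sym (*-assoc z x (y ⁻¹)))

  χᴾ-neg-frac : ∀ x y → χᴾ (scale (- 1#) (frac (- x) y)) ≡ χ (y * x)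
  χᴾ-neg-frac x y = begin
    χᴾ (scale (- 1#) (frac (- x) y))  ≡⟨ cong χᴾ (scale-frac (- 1#) (- x) y) ⟩
    χᴾ (frac (- 1# * - x) y)          ≡⟨ χᴾ-frac (- 1# * - x) y ⟩
    χ (- 1# * - x * y)                ≡⟨ cong χ (solve 2 (λ x y → :- con (ℤ.+ 1) :* :- x :* y := y :* x) refl x y) ⟩
    χ (y * x)                         ∎

  image-square : ∀ {p} → (Σ F λ x → (p ≡ pt x) × IsSquare x) ⇔ χᴾ p ≡ unit Sign.+
  image-square {∞}    = mk⇔ (λ { (_ , () , _) }) (λ ())
  image-square {pt y} = mk⇔ (λ { (_ , refl , y□) → Equivalence.to square⇔χ≡+ y□ })
                            (λ χy≡+ → y , refl , Equivalence.from square⇔χ≡+ χy≡+)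

  Region : Signs → P1 → P1 → Set
  Region σ (pt s) (pt t) = Match σ (χ s) (χ t) (χ (t + - s))
  Region σ _      _      = ⊥

  neg-Region : ∀ σ p q → neg ζ (Region σ) p q ⇔ Region (opposite³ σ) p q
  neg-Region σ ∞      _      = ⇔.refl
  neg-Region σ (pt s) ∞      = ⇔.refl
  neg-Region σ (pt s) (pt t) = ⇔.trans
    (Match-cong σ (χ-ζ* s) (χ-ζ* t) (trans (cong χ ζt-ζs≡ζ[t-s]) (χ-ζ* (t + - s))))
    (⊟·k≡unit ×-⇔ ⊟·k≡unit ×-⇔ ⊟·k≡unit)
    where
    ζt-ζs≡ζ[t-s] : ζ * t + - (ζ * s) ≡ ζ * (t + - s)
    ζt-ζs≡ζ[t-s] = solve 3 (λ ζ s t → ζ :* t :+ :- (ζ :* s) := ζ :* (t :+ :- s)) refl ζ s t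
    χ-ζ* : ∀ x → χ (ζ * x) ≡ unit Sign.- · χ x
    χ-ζ* x = trans (χ-* ζ x) (cong (_· χ x) (Equivalence.to nonsquare⇔χ≡- ζ-nonsquare))

  module Coefficients (w : Weights) where
    open Weights w

    onImage₀ onImage∞ onPreimage∞ onPreimage₀ : P1 → ℚ
    onImage₀ y    = 𝟙 (does (χᴾ y ≟ᶜ unit Sign.+)) +ℚ α *ℚ ⟦ χᴾ y ⟧
    onImage∞ y    = β *ℚ ⟦ χᴾ y ⟧
    onPreimage∞ x = γ *ℚ ⟦ χᴾ (scale (- 1#) x) ⟧
    onPreimage₀ x = δ *ℚ ⟦ χᴾ (scale (- 1#) x) ⟧

    coefficients : P1 → P1 → ℚ
    coefficients = fourStars onImage₀ onImage∞ onPreimage∞ onPreimage₀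

  open Coefficients using (coefficients)

  module Matrix {a b c d : F} (det : a * d + - (b * c) ≡ 1#) where

    g : SL2
    g = mat a b c d det

    act-pt : ∀ u → act g (pt u) ≡ frac (a * u + b) (c * u + d)
    act-pt u with (c * u + d) ≟ 0#
    ... | yes _ = refl
    ... | no _  = refl

    act-∞ : act g ∞ ≡ frac a c
    act-∞ with c ≟ 0#
    ... | yes _ = refl
    ... | no _  = refl

    det≢0 : a * d + - (b * c) ≢ 0#
    det≢0 det≡0 = 1≢0 (trans (sym det) det≡0)

    c≡0⇒d≢0 : c ≡ 0# → d ≢ 0#
    c≡0⇒d≢0 c≡0 d≡0 = det≢0 (trans (cong₂ (λ c d → a * d + - (b * c)) c≡0 d≡0)
      (solve 2 (λ a b → a :* con (ℤ.+ 0) :+ :- (b :* con (ℤ.+ 0)) := con (ℤ.+ 0)) refl a b))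

    a≡0⇒b≢0 : a ≡ 0# → b ≢ 0#
    a≡0⇒b≢0 a≡0 b≡0 = det≢0 (trans (cong₂ (λ a b → a * d + - (b * c)) a≡0 b≡0)
      (solve 2 (λ c d → con (ℤ.+ 0) :* d :+ :- (con (ℤ.+ 0) :* c) := con (ℤ.+ 0)) refl c d))

    a≡0⇒c≢0 : a ≡ 0# → c ≢ 0#
    a≡0⇒c≢0 a≡0 c≡0 = det≢0 (trans (cong₂ (λ a c → a * d + - (b * c)) a≡0 c≡0)
      (solve 2 (λ b d → con (ℤ.+ 0) :* d :+ :- (b :* con (ℤ.+ 0)) := con (ℤ.+ 0)) refl b d))

    rows-independent : ∀ u → a * u + b ≡ 0# → c * u + d ≡ 0# → ⊥
    rows-independent u au+b≡0 cu+d≡0 = det≢0 (begin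
      a * d + - (b * c)
        ≡⟨ solve 5 (λ u a b c d → a :* d :+ :- (b :* c) := a :* (c :* u :+ d) :+ :- (c :* (a :* u :+ b))) refl u a b c d ⟩
      a * (c * u + d) + - (c * (a * u + b))
        ≡⟨ cong₂ (λ s t → a * s + - (c * t)) cu+d≡0 au+b≡0 ⟩
      a * 0# + - (c * 0#)
        ≡⟨ solve 2 (λ a c → a :* con (ℤ.+ 0) :+ :- (c :* con (ℤ.+ 0)) := con (ℤ.+ 0)) refl a c ⟩
      0# ∎)

    preimage-∞ : UniquePreimage g ∞ (frac (- d) c)
    preimage-∞ = hits , only
      where
      hits : act g (frac (- d) c) ≡ ∞
      hits with c ≟ 0#
      ... | yes c≡0 = trans act-∞ (frac-∞ c≡0)
      ... | no c≢0  = trans (act-pt _) (frac-∞ (Equivalence.from (linear-root c≢0) refl))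
      only : ∀ {x} → act g x ≡ ∞ → x ≡ frac (- d) c
      only {∞}    g∞≡∞ = sym (frac-∞ (frac≡∞⇒ (trans (sym act-∞) g∞≡∞)))
      only {pt u} gu≡∞ = root-is-frac c≡0⇒d≢0 (frac≡∞⇒ (trans (sym (act-pt u)) gu≡∞))

    preimage-0 : UniquePreimage g (pt 0#) (frac (- b) a)
    preimage-0 = hits , only
      where
      hits : act g (frac (- b) a) ≡ pt 0#
      hits with a ≟ 0#
      ... | yes a≡0 = trans act-∞ (trans (frac-pt (a≡0⇒c≢0 a≡0)) (cong pt (trans (cong (_* c ⁻¹) a≡0) (zeroˡ _))))
      ... | no a≢0  = trans (act-pt u) (trans (frac-pt cu+d≢0) (cong pt (trans (cong (_* (c * u + d) ⁻¹) au+b≡0) (zeroˡ _))))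
        where
        u : F
        u = - b * a ⁻¹
        au+b≡0 : a * u + b ≡ 0#
        au+b≡0 = Equivalence.from (linear-root a≢0) refl
        cu+d≢0 : c * u + d ≢ 0#
        cu+d≢0 = rows-independent u au+b≡0
      only : ∀ {x} → act g x ≡ pt 0# → x ≡ frac (- b) a
      only {∞} g∞≡0 with frac≡pt⇒ (trans (sym act-∞) g∞≡0)
      ... | c≢0 , a/c≡0 = sym (frac-∞ (x*y≡0⇒x≡0 (⁻¹≢0 c≢0) a/c≡0))
      only {pt u} gu≡0 with frac≡pt⇒ (trans (sym (act-pt u)) gu≡0)
      ... | cu+d≢0 , au+b/cu+d≡0 = root-is-frac a≡0⇒b≢0 (x*y≡0⇒x≡0 (⁻¹≢0 cu+d≢0) au+b/cu+d≡0)

    image-0 : act g (pt 0#) ≡ frac b d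
    image-0 = trans (act-pt 0#) (cong₂ frac (trans (cong (_+ b) (zeroʳ a)) (+-identityˡ b))
                                            (trans (cong (_+ d) (zeroʳ c)) (+-identityˡ d)))

    ad≡1 : b ≡ 0# ⊎ c ≡ 0# → a * d ≡ 1#
    ad≡1 b≡0∨c≡0 = begin
      a * d                  ≡⟨ sym (+-identityʳ _) ⟩
      a * d + 0#             ≡⟨ cong (a * d +_) (sym -0#≈0#) ⟩
      a * d + - 0#           ≡⟨ cong (λ t → a * d + - t) (sym (x≡0∨y≡0⇒x*y≡0 b≡0∨c≡0)) ⟩
      a * d + - (b * c)      ≡⟨ det ⟩
      1#                     ∎

    bc≡-1 : a ≡ 0# ⊎ d ≡ 0# → b * c ≡ - 1#
    bc≡-1 a≡0∨d≡0 = begin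
      b * c                  ≡⟨ sym (-‿involutive _) ⟩
      - - (b * c)            ≡⟨ cong -_ (sym (+-identityˡ _)) ⟩
      - (0# + - (b * c))     ≡⟨ cong (λ t → - (t + - (b * c))) (sym (x≡0∨y≡0⇒x*y≡0 a≡0∨d≡0)) ⟩
      - (a * d + - (b * c))  ≡⟨ cong -_ det ⟩
      - 1#                   ∎

    χ-pattern : ∀ {m} → χ (- 1#) ≡ unit m → Pattern m (χ (b * d)) (χ (a * c)) (χ (c * d)) (χ (a * b))
    χ-pattern {m} χ[-1]≡m with c ≟ 0# | d ≟ 0# | a ≟ 0# | b ≟ 0#
    ... | yes c≡0 | _ | _ | _ = Pattern-cong refl (χ-zeroʳ c≡0) (χ-zeroˡ c≡0) (begin
      χ (a * b)               ≡⟨ sym (χ-*-square (a * b) (c≡0⇒d≢0 c≡0)) ⟩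
      χ (a * b * (d * d))     ≡⟨ cong χ (solve 3 (λ a b d → a :* b :* (d :* d) := b :* d :* (a :* d)) refl a b d) ⟩
      χ (b * d * (a * d))     ≡⟨ cong (λ t → χ (b * d * t)) (ad≡1 (inj₂ c≡0)) ⟩
      χ (b * d * 1#)          ≡⟨ cong χ (*-identityʳ _) ⟩
      χ (b * d)               ∎) (zero-c _)
    ... | no c≢0 | yes d≡0 | _ | _ = Pattern-cong (χ-zeroʳ d≡0) refl (χ-zeroʳ d≡0) (begin
      χ (a * b)               ≡⟨ sym (χ-*-square (a * b) c≢0) ⟩
      χ (a * b * (c * c))     ≡⟨ cong χ (solve 3 (λ a b c → a :* b :* (c :* c) := a :* c :* (b :* c)) refl a b c) ⟩
      χ (a * c * (b * c))     ≡⟨ χ-* (a * c) (b * c) ⟩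
      χ (a * c) · χ (b * c)   ≡⟨ cong (λ t → χ (a * c) · χ t) (bc≡-1 (inj₂ d≡0)) ⟩
      χ (a * c) · χ (- 1#)    ≡⟨ cong (χ (a * c) ·_) χ[-1]≡m ⟩
      χ (a * c) · unit m      ∎) (zero-d _)
    ... | no c≢0 | no d≢0 | yes a≡0 | _ = Pattern-cong refl (χ-zeroˡ a≡0) refl (χ-zeroˡ a≡0) (zero-a′ (begin
      χ (b * d) · χ (c * d)   ≡⟨ sym (χ-* (b * d) (c * d)) ⟩
      χ (b * d * (c * d))     ≡⟨ cong χ (solve 3 (λ b c d → b :* d :* (c :* d) := b :* c :* (d :* d)) refl b c d) ⟩
      χ (b * c * (d * d))     ≡⟨ χ-*-square (b * c) d≢0 ⟩
      χ (b * c)               ≡⟨ cong χ (bc≡-1 (inj₁ a≡0)) ⟩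
      χ (- 1#)                ≡⟨ χ[-1]≡m ⟩
      unit m                  ∎))
    ... | no c≢0 | no d≢0 | no a≢0 | yes b≡0 = Pattern-cong (χ-zeroˡ b≡0) refl refl (χ-zeroʳ b≡0) (zero-b′ (begin
      χ (a * c) · χ (c * d)   ≡⟨ sym (χ-* (a * c) (c * d)) ⟩
      χ (a * c * (c * d))     ≡⟨ cong χ (solve 3 (λ a c d → a :* c :* (c :* d) := a :* d :* (c :* c)) refl a c d) ⟩
      χ (a * d * (c * c))     ≡⟨ χ-*-square (a * d) c≢0 ⟩
      χ (a * d)               ≡⟨ cong χ (ad≡1 (inj₁ b≡0)) ⟩
      χ 1#                    ≡⟨ χ-1 ⟩
      unit Sign.+             ∎))
    ... | no c≢0 | no d≢0 | no a≢0 | no b≢0 = Pattern-cong refl refl refl (begin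
      χ (a * b)
        ≡⟨ sym (χ-*-square (a * b) (x*y≢0 c≢0 d≢0)) ⟩
      χ (a * b * (c * d * (c * d)))
        ≡⟨ cong χ (solve 4 (λ a b c d → a :* b :* (c :* d :* (c :* d)) := b :* d :* (a :* c :* (c :* d))) refl a b c d) ⟩
      χ (b * d * (a * c * (c * d)))
        ≡⟨ χ-* (b * d) _ ⟩
      χ (b * d) · χ (a * c * (c * d))
        ≡⟨ cong (χ (b * d) ·_) (χ-* (a * c) (c * d)) ⟩
      χ (b * d) · (χ (a * c) · χ (c * d)) ∎)
      (all-nonzero′ (χ-≢0 (x*y≢0 b≢0 d≢0)) (χ-≢0 (x*y≢0 a≢0 c≢0)) (χ-≢0 (x*y≢0 c≢0 d≢0)))

    region : ∀ σ → A (Region σ) g ⇔ Match σ (χ (b * d)) (χ (a * c)) (χ (c * d))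
    region σ = subst₂ (λ p q → Region σ p q ⇔ Match σ (χ (b * d)) (χ (a * c)) (χ (c * d)))
                      (sym image-0) (sym act-∞) region-frac
      where
      χ[cd]≢unit : ∀ {s} → c ≡ 0# ⊎ d ≡ 0# → χ (c * d) ≢ unit s
      χ[cd]≢unit c≡0∨d≡0 χ[cd]≡s with trans (sym (trans (cong χ (x≡0∨y≡0⇒x*y≡0 c≡0∨d≡0)) χ-0)) χ[cd]≡s
      ... | ()
      -- the determinant is 1, so g(∞) - g(0) = a/c - b/d = 1/(cd)
      difference : c ≢ 0# → d ≢ 0# → a * c ⁻¹ + - (b * d ⁻¹) ≡ c ⁻¹ * d ⁻¹
      difference c≢0 d≢0 = begin
        a * c ⁻¹ + - (b * d ⁻¹)
          ≡⟨ solve 4 (λ a b c′ d′ → a :* c′ :+ :- (b :* d′) := a :* c′ :* con (ℤ.+ 1) :+ :- (b :* d′ :* con (ℤ.+ 1)))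
                   refl a b (c ⁻¹) (d ⁻¹) ⟩
        a * c ⁻¹ * 1# + - (b * d ⁻¹ * 1#)
          ≡⟨ cong₂ (λ s t → a * c ⁻¹ * s + - (b * d ⁻¹ * t)) (sym (inverseʳ d d≢0)) (sym (inverseʳ c c≢0)) ⟩
        a * c ⁻¹ * (d * d ⁻¹) + - (b * d ⁻¹ * (c * c ⁻¹))
          ≡⟨ solve 6 (λ a b c d c′ d′ → a :* c′ :* (d :* d′) :+ :- (b :* d′ :* (c :* c′)) := c′ :* d′ :* (a :* d :+ :- (b :* c)))
                   refl a b c d (c ⁻¹) (d ⁻¹) ⟩
        c ⁻¹ * d ⁻¹ * (a * d + - (b * c))
          ≡⟨ cong (c ⁻¹ * d ⁻¹ *_) det ⟩
        c ⁻¹ * d ⁻¹ * 1#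
          ≡⟨ *-identityʳ _ ⟩
        c ⁻¹ * d ⁻¹ ∎
      region-frac : Region σ (frac b d) (frac a c) ⇔ Match σ (χ (b * d)) (χ (a * c)) (χ (c * d))
      region-frac with d ≟ 0# | c ≟ 0#
      ... | yes d≡0 | _       = mk⇔ (λ ()) (λ (_ , _ , Z≡s) → χ[cd]≢unit (inj₂ d≡0) Z≡s)
      ... | no _    | yes c≡0 = mk⇔ (λ ()) (λ (_ , _ , Z≡s) → χ[cd]≢unit (inj₁ c≡0) Z≡s)
      ... | no d≢0  | no c≢0  = Match-cong σ (χ-÷ b d≢0) (χ-÷ a c≢0) (begin
        χ (a * c ⁻¹ + - (b * d ⁻¹))  ≡⟨ cong χ (difference c≢0 d≢0) ⟩
        χ (c ⁻¹ * d ⁻¹)              ≡⟨ χ-* (c ⁻¹) (d ⁻¹) ⟩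
        χ (c ⁻¹) · χ (d ⁻¹)          ≡⟨ cong₂ _·_ (χ-⁻¹ c≢0) (χ-⁻¹ d≢0) ⟩
        χ c · χ d                    ≡⟨ sym (χ-* c d) ⟩
        χ (c * d)                    ∎)

    Ls⇔ : Ls g ⇔ χ (b * d) ≡ unit Sign.+
    Ls⇔ = ⇔.trans image-square (mk⇔ (trans (sym χ-image-0)) (trans χ-image-0))
      where
      χ-image-0 : χᴾ (act g (pt 0#)) ≡ χ (b * d)
      χ-image-0 = trans (cong χᴾ image-0) (χᴾ-frac b d)

    combo-value : ∀ w → combo (coefficients w) g ≡ value w (χ (b * d)) (χ (a * c)) (χ (c * d)) (χ (a * b))
    combo-value w = trans (combo-fourStars onImage₀ onImage∞ onPreimage∞ onPreimage₀ preimage-∞ preimage-0)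
      (value-cong w (trans (cong χᴾ image-0) (χᴾ-frac b d)) (trans (cong χᴾ act-∞) (χᴾ-frac a c))
                    (χᴾ-neg-frac d c) (χᴾ-neg-frac b a))
      where open Coefficients w

  cameronLiebler : ∀ {m} σ w → χ (- 1#) ≡ unit m →
    (∀ {X Y Z W} → Pattern m X Y Z W → value w X Y Z W ≡ 𝟙 (does (member? σ X Y Z))) →
    ∀ {Ω} → (∀ p q → Ω p q ⇔ Region σ p q) → CameronLiebler (λ g → (Ls g × ¬ A Ω g) ⊎ A (neg ζ Ω) g)
  cameronLiebler σ w χ[-1]≡m table Ω⇔Region = coefficients w , λ where
    g@(mat a b c d det) → let open Matrix det in
      𝟙-characteristic (member? σ _ _ _)
        (Ls⇔ ×-⇔ ¬-cong-⇔ (⇔.trans (Ω⇔Region _ _) (region σ))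
             ⊎-⇔ ⇔.trans (Ω⇔Region _ _) (⇔.trans (neg-Region σ _ _) (region (opposite³ σ))))
        (trans (combo-value w) (table (χ-pattern χ[-1]≡m)))

-- The sets built from Π and Λ

¼ : ℚ
¼ = ℤ.+ 1 / 4

Π-signs Λ-signs : Signs
Π-signs = Sign.+ , Sign.- , Sign.+
Λ-signs = Sign.+ , Sign.+ , Sign.-

Π-weights Λ-weights : Weights
Π-weights = record { α = ℚ.- ¼ ; β = ¼ ; γ = ℚ.- ¼ ; δ = ¼ }
Λ-weights = record { α = ℚ.- ¼ ; β = ℚ.- ¼ ; γ = ¼ ; δ = ¼ }

Π-table : ∀ {X Y Z W} → Pattern Sign.- X Y Z W → value Π-weights X Y Z W ≡ 𝟙 (does (member? Π-signs X Y Z))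
Π-table (zero-c zero) = refl
Π-table (zero-c (unit Sign.+)) = refl
Π-table (zero-c (unit Sign.-)) = refl
Π-table (zero-d zero) = refl
Π-table (zero-d (unit Sign.+)) = refl
Π-table (zero-d (unit Sign.-)) = refl
Π-table (zero-a Sign.+ Sign.- refl) = refl
Π-table (zero-a Sign.- Sign.+ refl) = refl
Π-table (zero-b Sign.+) = refl
Π-table (zero-b Sign.-) = refl
Π-table (all-nonzero Sign.+ Sign.+ Sign.+) = refl
Π-table (all-nonzero Sign.+ Sign.+ Sign.-) = refl
Π-table (all-nonzero Sign.+ Sign.- Sign.+) = refl
Π-table (all-nonzero Sign.+ Sign.- Sign.-) = refl
Π-table (all-nonzero Sign.- Sign.+ Sign.+) = refl
Π-table (all-nonzero Sign.- Sign.+ Sign.-) = refl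
Π-table (all-nonzero Sign.- Sign.- Sign.+) = refl
Π-table (all-nonzero Sign.- Sign.- Sign.-) = refl

Λ-table : ∀ {X Y Z W} → Pattern Sign.+ X Y Z W → value Λ-weights X Y Z W ≡ 𝟙 (does (member? Λ-signs X Y Z))
Λ-table (zero-c zero) = refl
Λ-table (zero-c (unit Sign.+)) = refl
Λ-table (zero-c (unit Sign.-)) = refl
Λ-table (zero-d zero) = refl
Λ-table (zero-d (unit Sign.+)) = refl
Λ-table (zero-d (unit Sign.-)) = refl
Λ-table (zero-a Sign.+ Sign.+ refl) = refl
Λ-table (zero-a Sign.- Sign.- refl) = refl
Λ-table (zero-b Sign.+) = refl
Λ-table (zero-b Sign.-) = refl
Λ-table (all-nonzero Sign.+ Sign.+ Sign.+) = refl
Λ-table (all-nonzero Sign.+ Sign.+ Sign.-) = refl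
Λ-table (all-nonzero Sign.+ Sign.- Sign.+) = refl
Λ-table (all-nonzero Sign.+ Sign.- Sign.-) = refl
Λ-table (all-nonzero Sign.- Sign.+ Sign.+) = refl
Λ-table (all-nonzero Sign.- Sign.+ Sign.-) = refl
Λ-table (all-nonzero Sign.- Sign.- Sign.+) = refl
Λ-table (all-nonzero Sign.- Sign.- Sign.-) = refl

module ΠΛ-Regions (𝔽 : FiniteField) {ζ} (ζ-nonsquare : Over.IsNonSquare 𝔽 ζ) where
  open Over 𝔽
  open QuadraticCharacter 𝔽
  open ProjectiveAction 𝔽 ζ-nonsquare

  Π⇔Region : ∀ p q → Π p q ⇔ Region Π-signs p q
  Π⇔Region (pt s) (pt t) = square⇔χ≡+ ×-⇔ nonsquare⇔χ≡- ×-⇔ square⇔χ≡+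
  Π⇔Region (pt s) ∞      = ⇔.refl
  Π⇔Region ∞      _      = ⇔.refl

  Λ⇔Region : ∀ p q → Λ p q ⇔ Region Λ-signs p q
  Λ⇔Region (pt s) (pt t) = square⇔χ≡+ ×-⇔ square⇔χ≡+ ×-⇔ nonsquare⇔χ≡-
  Λ⇔Region (pt s) ∞      = ⇔.refl
  Λ⇔Region ∞      _      = ⇔.refl

theorem7p3 : (𝔽 : FiniteField) → let open Over 𝔽 in
    (ζ : FiniteField.F 𝔽) → IsNonSquare ζ →
      (FiniteField.order 𝔽 % 4 ≡ 3 →
        CameronLiebler (λ g → (Ls g × ¬ A Π g) ⊎ A (neg ζ Π) g))
    × (FiniteField.order 𝔽 % 4 ≡ 1 →
        CameronLiebler (λ g → (Ls g × ¬ A Λ g) ⊎ A (neg ζ Λ) g))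
theorem7p3 𝔽 ζ ζ-nonsquare =
    (λ q%4≡3 → cameronLiebler Π-signs Π-weights (order%4≡3⇒χ[-1]≡- q%4≡3) Π-table Π⇔Region)
  , (λ q%4≡1 → cameronLiebler Λ-signs Λ-weights (order%4≡1⇒χ[-1]≡+ q%4≡1) Λ-table Λ⇔Region)
  where
  open QuadraticCharacter 𝔽
  open OddCharacteristic ζ-nonsquare
  open ProjectiveAction 𝔽 ζ-nonsquare
  open ΠΛ-Regions 𝔽 ζ-nonsquare
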